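{- Let $p\ge 11$ be a prime. Let $c$ be an integer such that $2c\equiv -1\pmod p$ (i.e., $c=\frac{p-1}{2}$ in $\mathbb{Z}_p$). Define subsets of $\mathbb{Z}_p$ by $$B=\{0,1,c\},\qquad A=\mathbb{Z}_p\setminus\{ -1,-c,-2\}.$$ Then $|A|=p-3$, $|B|=3$, $|A|+|B|=p$, and $$|A\widehat{+}B|=p-2.$$ Moreover, neither $A$ nor $B$ is an arithmetic progression.
   Context: $\mathbb{Z}_p=\mathbb{Z}/p\mathbb{Z}$ is the cyclic group of order $p$; integers are identified with their residue classes modulo $p$. For nonempty $A,B\subset\mathbb{Z}_p$, the restricted sumset is $A\widehat{+}B=\{a+b: a\in A,\ b\in B,\ a\neq b\}$. A subset of $\mathbb{Z}_p$ of size $m$ is an arithmetic progression if it has the form $\{a_0+id: 0\le i\le m-1\}$ for some $a_0,d\in\mathbb{Z}_p$ with $d\neq 0$. -}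

module Defs where

open import Data.Fin.Base using (Fin; toℕ; fromℕ<)
open import Data.Fin.Properties using (_≟_; any?)
open import Data.Fin.Subset using (Subset; _∈_; ∣_∣)
open import Data.Fin.Subset.Properties using (_∈?_)
open import Data.Integer.Base as ℤ using (ℤ; +_; _-_)
open import Data.Integer.Divisibility using (_∣_)
open import Data.Integer.DivMod using (_%ℕ_; n%ℕd<d)
open import Data.Nat.Base as ℕ using (ℕ; NonZero)
open import Data.Product.Base using (∃-syntax; _×_)
open import Data.Vec.Base using (tabulate)
open import Function.Bundles using (_⇔_)
open import Relation.Binary.PropositionalEquality.Core using (_≡_; _≢_)
open import Relation.Nullary.Decidable using (Dec; does; ¬?; _×-dec_)

infix 4 _≡_[mod_]

_≡_[mod_] : ℤ → ℤ → ℕ → Set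
i ≡ j [mod n ] = + n ∣ i - j

-- The ring ℤ/nℤ is carried by Fin n, each class being represented by its
-- least non-negative element.
module _ {n : ℕ} .{{_ : NonZero n}} where

  infixl 6 _⊕_ _+̂_
  infixl 7 _⊗_

  residue : ℤ → Fin n
  residue i = fromℕ< (n%ℕd<d i n)

  _⊕_ _⊗_ : Fin n → Fin n → Fin n
  a ⊕ b = residue (+ (toℕ a ℕ.+ toℕ b))
  a ⊗ b = residue (+ (toℕ a ℕ.* toℕ b))

  IsRestrictedSum : Subset n → Subset n → Fin n → Set
  IsRestrictedSum A B s =
    ∃[ a ] ∃[ b ] (a ∈ A × b ∈ B × a ≢ b × s ≡ a ⊕ b)

  isRestrictedSum? : ∀ A B s → Dec (IsRestrictedSum A B s)
  isRestrictedSum? A B s =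
    any? λ a → any? λ b →
      (a ∈? A) ×-dec (b ∈? B) ×-dec ¬? (a ≟ b) ×-dec (s ≟ a ⊕ b)

  _+̂_ : Subset n → Subset n → Subset n
  A +̂ B = tabulate λ s → does (isRestrictedSum? A B s)

  IsArithmeticProgression : Subset n → Set
  IsArithmeticProgression S =
    ∃[ a₀ ] ∃[ d ] (d ≢ residue (+ 0) ×
      (∀ x → x ∈ S ⇔ (∃[ i ] (i ℕ.< ∣ S ∣ × x ≡ a₀ ⊕ residue (+ i) ⊗ d))))

{-# OPTIONS --safe #-}
-- A class s is missed by A +̂ B exactly when s ∈ {b - 1, b - c, b - 2, 2b} for
-- every b ∈ B.  Since 2c ≡ -1, both 0 and -1 are missed; any other class is
-- a sum with b = 0, unless it is -c or -2, in which case b = 1 works.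
-- If A were an arithmetic progression with difference d, then so would be its
-- three-element complement, because the multiples kd with 0 < k < p do not
-- vanish.  So in either case one of the elements of {0, 1, c} or of
-- {-1, -c, -2} would be the midpoint of the other two; with 2c ≡ -1 this forces
-- p to divide one of 1, 2, 4, 5, 7.
module Submission where

open import Defs
open import Data.Fin.Base using (Fin; zero; suc; toℕ)
open import Data.Fin.Properties using (toℕ-fromℕ<; toℕ<n; toℕ-injective)
open import Data.Fin.Subset using (Subset; inside; outside; _∈_; _∉_; ⁅_⁆; _∪_; ∁; ∣_∣)
open import Data.Fin.Subset.Properties
  using (x∈⁅x⁆; x∈⁅y⁆⇒x≡y; x∈p∪q⁻; x∈p∪q⁺; ∪-identityˡ; ∣⁅x⁆∣≡1; ∣∁p∣≡n∸∣p∣;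
         x∈∁p⇒x∉p; x∉∁p⇒x∈p; x∉p⇒x∈∁p; ⊆-antisym; _∈?_)
open import Data.Integer.Base as ℤ using (ℤ; +_; -_; _-_)
open import Data.Integer.Divisibility.Signed as Signed using (∣ᵤ⇒∣; ∣⇒∣ᵤ; ∣m∣n⇒∣m+n; ∣n⇒∣m*n)
open import Data.Integer.DivMod using (_%ℕ_; _/ℕ_; n%ℕd<d; a≡a%ℕn+[a/ℕn]*n)
import Data.Integer.Properties as ℤ
open import Data.Integer.Tactic.RingSolver using (solve)
open import Data.List.Base using ([]; _∷_)
open import Data.Nat.Base using (ℕ; NonZero; >-nonZero; >-nonZero⁻¹; _≤_; _<_; _+_; _∸_; z<s; s<s)
open import Data.Nat.Divisibility using (_∣_; >⇒∤)
open import Data.Nat.Primality using (Prime; euclidsLemma)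
import Data.Nat.Properties as ℕ
open import Data.Product.Base using (_×_; _,_; ∃-syntax)
open import Data.Sum.Base using (_⊎_; inj₁; inj₂; [_,_]′; map)
open import Data.Vec.Base as Vec using (here; there; tabulate)
open import Data.Vec.Properties using ([]=⇒lookup; lookup⇒[]=; lookup∘tabulate)
open import Function.Base using (_∘_; _|>′_)
open import Function.Bundles using (Equivalence)
open import Relation.Binary.PropositionalEquality
  using (_≡_; refl; sym; trans; cong; cong₂; subst; module ≡-Reasoning)
open import Relation.Nullary.Decidable using (Dec; yes; no; does; True; toSum; toWitness; dec-true)
open import Relation.Nullary.Negation.Core using (¬_; contradiction)

-- Congruence of integers modulo `n`.

private variable
  n : ℕ
  i j k l x y z e f g : ℤ

-- _≡_[mod_] unfolds to a divisibility of natural numbers from which Agda cannot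
-- recover i and j; the record makes them inferable.
infix 4 _≅_[mod_]

record _≅_[mod_] (i j : ℤ) (n : ℕ) : Set where
  constructor congruent
  field difference : + n Signed.∣ i - j

open _≅_[mod_]

-- Certificates for congruences: once the multiplier `u` is named, what remains is an integer
-- identity for the ring solver. `bilinear` is the version with two premises.
linear : ∀ u → i ≅ j [mod n ] → x - y ≡ u ℤ.* (i - j) → x ≅ y [mod n ]
linear {n = n} u i≅j eq =
  congruent (subst (+ n Signed.∣_) (sym eq) (∣n⇒∣m*n u (difference i≅j)))

bilinear : ∀ u v → i ≅ j [mod n ] → k ≅ l [mod n ] →
           x - y ≡ u ℤ.* (i - j) ℤ.+ v ℤ.* (k - l) → x ≅ y [mod n ]
bilinear {n = n} u v i≅j k≅l eq = congruent (subst (+ n Signed.∣_) (sym eq)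
  (∣m∣n⇒∣m+n (∣n⇒∣m*n u (difference i≅j)) (∣n⇒∣m*n v (difference k≅l))))

≅-refl : i ≅ i [mod n ]
≅-refl {i} {n} = congruent (subst (+ n Signed.∣_) (sym (ℤ.+-inverseʳ i)) (Signed.divides (+ 0) refl))

≅-reflexive : i ≡ j → i ≅ j [mod n ]
≅-reflexive refl = ≅-refl

≅-sym : i ≅ j [mod n ] → j ≅ i [mod n ]
≅-sym {i} {j} i≅j = linear (- (+ 1)) i≅j (solve (i ∷ j ∷ []))

≅-trans : i ≅ j [mod n ] → j ≅ k [mod n ] → i ≅ k [mod n ]
≅-trans {i} {j} {k = k} i≅j j≅k = bilinear (+ 1) (+ 1) i≅j j≅k (solve (i ∷ j ∷ k ∷ []))

+-cong : i ≅ j [mod n ] → k ≅ l [mod n ] → i ℤ.+ k ≅ j ℤ.+ l [mod n ]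
+-cong {i} {j} {k = k} {l} i≅j k≅l =
  bilinear (+ 1) (+ 1) i≅j k≅l (solve (i ∷ j ∷ k ∷ l ∷ []))

*-cong : i ≅ j [mod n ] → k ≅ l [mod n ] → i ℤ.* k ≅ j ℤ.* l [mod n ]
*-cong {i} {j} {k = k} {l} i≅j k≅l = bilinear k j i≅j k≅l (solve (i ∷ j ∷ k ∷ l ∷ []))

≅0⇒∣ : i ≅ + 0 [mod n ] → n ∣ ℤ.∣ i ∣
≅0⇒∣ {i} {n} i≅0 = subst (λ j → n ∣ ℤ.∣ j ∣) (ℤ.+-identityʳ i) (∣⇒∣ᵤ (difference i≅0))

small≇0 : ∀ m .{{_ : NonZero m}} → m < n → ¬ (+ m ≅ + 0 [mod n ])
small≇0 m m<n m≅0 = >⇒∤ m<n (≅0⇒∣ m≅0)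

-- By Euclid's lemma `p` would divide `m` or `δ`; the first is excluded by size, the second by
-- hypothesis.
multiple≇0 : ∀ {p δ} → Prime p → ¬ (δ ≅ + 0 [mod p ]) →
             ∀ m .{{_ : NonZero m}} → m < p → ¬ (+ m ℤ.* δ ≅ + 0 [mod p ])
multiple≇0 {p} {δ} p-prime δ≇0 m m<p mδ≅0
  with euclidsLemma m ℤ.∣ δ ∣ p-prime (subst (p ∣_) (ℤ.abs-* (+ m) δ) (≅0⇒∣ mδ≅0))
... | inj₁ p∣m = >⇒∤ m<p p∣m
... | inj₂ p∣δ = δ≇0 (congruent (subst (+ p Signed.∣_) (sym (ℤ.+-identityʳ δ)) (∣ᵤ⇒∣ p∣δ)))

-- Residue classes and small sets of them.

module _ {n : ℕ} .{{_ : NonZero n}} where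

  toℕ-residue : ∀ i → + toℕ (residue {n} i) ≅ i [mod n ]
  toℕ-residue i = ≅-sym (congruent (Signed.divides (i /ℕ n) (begin
    i - + toℕ (residue {n} i)         ≡⟨ cong (λ r → i - + r) (toℕ-fromℕ< (n%ℕd<d i n)) ⟩
    i - r                             ≡⟨ cong (_- r) (a≡a%ℕn+[a/ℕn]*n i n) ⟩
    (r ℤ.+ q) - r                     ≡⟨ cancel r q ⟩
    q                                 ∎)))
    where
    open ≡-Reasoning
    r = + (i %ℕ n)
    q = (i /ℕ n) ℤ.* + n
    cancel : ∀ r q → (r ℤ.+ q) - r ≡ q
    cancel r q = solve (r ∷ q ∷ [])

  -- Two least representatives differ by less than `n` in absolute value, and the only multiple of
  -- `n` that small is 0.
  toℕ-injective-mod : ∀ (a b : Fin n) → + toℕ a ≅ + toℕ b [mod n ] → a ≡ b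
  toℕ-injective-mod a b a≅b = toℕ-injective (ℤ.+-injective (ℤ.i-j≡0⇒i≡j _ _
    (ℤ.∣i∣≡0⇒i≡0 (vanishes ℤ.∣ + toℕ a - + toℕ b ∣ (∣⇒∣ᵤ (difference a≅b)) bound))))
    where
    bound : ℤ.∣ + toℕ a - + toℕ b ∣ < n
    bound = ℕ.≤-<-trans
      (ℕ.≤-trans (ℕ.≤-reflexive (cong ℤ.∣_∣ (ℤ.m-n≡m⊖n (toℕ a) (toℕ b))))
                 (ℤ.∣m⊝n∣≤m⊔n (toℕ a) (toℕ b)))
      (ℕ.⊔-pres-<m (toℕ<n a) (toℕ<n b))
    vanishes : ∀ m → n ∣ m → m < n → m ≡ 0
    vanishes ℕ.zero    _   _   = refl
    vanishes m@(ℕ.suc _) n∣m m<n = contradiction n∣m (>⇒∤ m<n)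

  residue-cong : i ≅ j [mod n ] → residue {n} i ≡ residue j
  residue-cong {i} {j} i≅j = toℕ-injective-mod _ _
    (≅-trans (toℕ-residue i) (≅-trans i≅j (≅-sym (toℕ-residue j))))

  residue-injective : residue {n} i ≡ residue j → i ≅ j [mod n ]
  residue-injective {i} {j} eq = ≅-trans (≅-sym (toℕ-residue i))
    (≅-trans (≅-reflexive (cong (+_ ∘ toℕ) eq)) (toℕ-residue j))

  residue-toℕ : ∀ a → residue {n} (+ toℕ a) ≡ a
  residue-toℕ a = toℕ-injective-mod _ _ (toℕ-residue (+ toℕ a))

  residue-⊕ : ∀ i j → residue {n} i ⊕ residue j ≡ residue (i ℤ.+ j)
  residue-⊕ i j = residue-cong (+-cong (toℕ-residue i) (toℕ-residue j))

  residue-⊗ : ∀ i j → residue {n} i ⊗ residue j ≡ residue (i ℤ.* j)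
  residue-⊗ i j = residue-cong (≅-trans
    (≅-reflexive (ℤ.pos-* (toℕ (residue {n} i)) (toℕ (residue {n} j))))
    (*-cong (toℕ-residue i) (toℕ-residue j)))

  ∈⁅residue⁆⁻ : ∀ i e → residue {n} i ∈ ⁅ residue e ⁆ → i ≅ e [mod n ]
  ∈⁅residue⁆⁻ i e = residue-injective {i} {e} ∘ x∈⁅y⁆⇒x≡y (residue e)

  ∈⁅residue⁆⁺ : ∀ i e → i ≅ e [mod n ] → residue {n} i ∈ ⁅ residue e ⁆
  ∈⁅residue⁆⁺ i e i≅e = subst (_∈ ⁅ residue e ⁆) (sym (residue-cong i≅e)) (x∈⁅x⁆ (residue e))

  pair⁻ : ∀ i e f → residue {n} i ∈ ⁅ residue e ⁆ ∪ ⁅ residue f ⁆ →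
          i ≅ e [mod n ] ⊎ i ≅ f [mod n ]
  pair⁻ i e f = map (∈⁅residue⁆⁻ i e) (∈⁅residue⁆⁻ i f) ∘ x∈p∪q⁻ _ _

  pair⁺ : ∀ i e f → i ≅ e [mod n ] ⊎ i ≅ f [mod n ] →
          residue {n} i ∈ ⁅ residue e ⁆ ∪ ⁅ residue f ⁆
  pair⁺ i e f = x∈p∪q⁺ ∘ map (∈⁅residue⁆⁺ i e) (∈⁅residue⁆⁺ i f)

  triple⁻ : ∀ i e f g → residue {n} i ∈ ⁅ residue e ⁆ ∪ ⁅ residue f ⁆ ∪ ⁅ residue g ⁆ →
            i ≅ e [mod n ] ⊎ i ≅ f [mod n ] ⊎ i ≅ g [mod n ]
  triple⁻ i e f g = map (∈⁅residue⁆⁻ i e) (pair⁻ i f g) ∘ x∈p∪q⁻ _ _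

  triple⁺ : ∀ i e f g → i ≅ e [mod n ] ⊎ i ≅ f [mod n ] ⊎ i ≅ g [mod n ] →
            residue {n} i ∈ ⁅ residue e ⁆ ∪ ⁅ residue f ⁆ ∪ ⁅ residue g ⁆
  triple⁺ i e f g = x∈p∪q⁺ ∘ map (∈⁅residue⁆⁺ i e) (pair⁺ i f g)

-- Sizes of sets of two or three residue classes.

∣⁅x⁆∪p∣≡1+∣p∣ : ∀ (x : Fin n) p → x ∉ p → ∣ ⁅ x ⁆ ∪ p ∣ ≡ ℕ.suc ∣ p ∣
∣⁅x⁆∪p∣≡1+∣p∣ zero    (inside  Vec.∷ p) x∉p = contradiction here x∉p
∣⁅x⁆∪p∣≡1+∣p∣ zero    (outside Vec.∷ p) x∉p = cong (ℕ.suc ∘ ∣_∣) (∪-identityˡ p)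
∣⁅x⁆∪p∣≡1+∣p∣ (suc x) (inside  Vec.∷ p) x∉p = cong ℕ.suc (∣⁅x⁆∪p∣≡1+∣p∣ x p (x∉p ∘ there))
∣⁅x⁆∪p∣≡1+∣p∣ (suc x) (outside Vec.∷ p) x∉p = ∣⁅x⁆∪p∣≡1+∣p∣ x p (x∉p ∘ there)

module _ {n : ℕ} .{{_ : NonZero n}} where

  ∣pair∣≡2 : ∀ e f → ¬ (e ≅ f [mod n ]) → ∣ ⁅ residue {n} e ⁆ ∪ ⁅ residue f ⁆ ∣ ≡ 2
  ∣pair∣≡2 e f e≇f = trans
    (∣⁅x⁆∪p∣≡1+∣p∣ (residue e) _ (e≇f ∘ ∈⁅residue⁆⁻ e f)) (cong ℕ.suc (∣⁅x⁆∣≡1 (residue f)))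

  ∣triple∣≡3 : ∀ e f g → ¬ (e ≅ f [mod n ]) → ¬ (e ≅ g [mod n ]) → ¬ (f ≅ g [mod n ]) →
               ∣ ⁅ residue {n} e ⁆ ∪ ⁅ residue f ⁆ ∪ ⁅ residue g ⁆ ∣ ≡ 3
  ∣triple∣≡3 e f g e≇f e≇g f≇g = trans
    (∣⁅x⁆∪p∣≡1+∣p∣ (residue e) _ ([ e≇f , e≇g ]′ ∘ pair⁻ e f g)) (cong ℕ.suc (∣pair∣≡2 f g f≇g))

-- Subsets cut out by a decidable predicate, such as `A +̂ B`.

module _ {P : Fin n → Set} (P? : ∀ x → Dec (P x)) where

  ∈-tabulate⁻ : ∀ x → x ∈ tabulate (does ∘ P?) → P x
  ∈-tabulate⁻ x x∈ with P? x | trans (sym (lookup∘tabulate (does ∘ P?) x)) ([]=⇒lookup x∈)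
  ... | yes px | _ = px
  ... | no  _  | ()

  ∈-tabulate⁺ : ∀ x → P x → x ∈ tabulate (does ∘ P?)
  ∈-tabulate⁺ x px =
    lookup⇒[]= x _ (trans (lookup∘tabulate (does ∘ P?) x) (dec-true (P? x) px))

-- Midpoints within a set of three classes.

OneOf : ℕ → ℤ → ℤ → ℤ → ℤ → Set
OneOf n e f g x = x ≅ e [mod n ] ⊎ x ≅ f [mod n ] ⊎ x ≅ g [mod n ]

-- With `y` in the slot `e`, distinctness leaves `f` and `g` for `x` and `z`, in an order that the
-- sum does not see.
endpoints : OneOf n e f g x → OneOf n e f g z → y ≅ e [mod n ] →
            ¬ (x ≅ y [mod n ]) → ¬ (z ≅ y [mod n ]) → ¬ (x ≅ z [mod n ]) →
            x ℤ.+ z ≅ f ℤ.+ g [mod n ]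
endpoints (inj₁ x≅e) _ y≅e x≇y _ _ = contradiction (≅-trans x≅e (≅-sym y≅e)) x≇y
endpoints _ (inj₁ z≅e) y≅e _ z≇y _ = contradiction (≅-trans z≅e (≅-sym y≅e)) z≇y
endpoints (inj₂ (inj₁ x≅f)) (inj₂ (inj₁ z≅f)) _ _ _ x≇z = contradiction (≅-trans x≅f (≅-sym z≅f)) x≇z
endpoints (inj₂ (inj₂ x≅g)) (inj₂ (inj₂ z≅g)) _ _ _ x≇z = contradiction (≅-trans x≅g (≅-sym z≅g)) x≇z
endpoints (inj₂ (inj₁ x≅f)) (inj₂ (inj₂ z≅g)) _ _ _ _ = +-cong x≅f z≅g
endpoints {f = f} {g} (inj₂ (inj₂ x≅g)) (inj₂ (inj₁ z≅f)) _ _ _ _ =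
  ≅-trans (+-cong x≅g z≅f) (≅-reflexive (ℤ.+-comm g f))

-- `swap₁₂` and `rotate` bring the class of `y` to the front, so that `endpoints` serves all three
-- positions; the other two classes keep their order.
swap₁₂ : OneOf n e f g x → OneOf n f e g x
swap₁₂ (inj₁ q)        = inj₂ (inj₁ q)
swap₁₂ (inj₂ (inj₁ q)) = inj₁ q
swap₁₂ (inj₂ (inj₂ q)) = inj₂ (inj₂ q)

rotate : OneOf n e f g x → OneOf n g e f x
rotate (inj₁ q)        = inj₂ (inj₁ q)
rotate (inj₂ (inj₁ q)) = inj₂ (inj₂ q)
rotate (inj₂ (inj₂ q)) = inj₁ q

-- Three distinct classes exhaust the three slots, so the slot taken by `y` is the midpoint of the
-- other two.
midpoint : OneOf n e f g x → OneOf n e f g y → OneOf n e f g z →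
           ¬ (x ≅ y [mod n ]) → ¬ (z ≅ y [mod n ]) → ¬ (x ≅ z [mod n ]) →
           x ℤ.+ z ≅ + 2 ℤ.* y [mod n ] →
           f ℤ.+ g ≅ + 2 ℤ.* e [mod n ] ⊎ e ℤ.+ g ≅ + 2 ℤ.* f [mod n ] ⊎ e ℤ.+ f ≅ + 2 ℤ.* g [mod n ]
midpoint {n} {x = x} {y} {z} x∈ y∈ z∈ x≇y z≇y x≇z x+z≅2y = go y∈
  where
  conclude : ∀ {s m} → x ℤ.+ z ≅ s [mod n ] → y ≅ m [mod n ] → s ≅ + 2 ℤ.* m [mod n ]
  conclude x+z≅s y≅m = ≅-trans (≅-sym x+z≅s) (≅-trans x+z≅2y (*-cong (≅-refl {+ 2}) y≅m))
  go : OneOf n _ _ _ y → _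
  go (inj₁ y≅e) = inj₁ (conclude (endpoints x∈ z∈ y≅e x≇y z≇y x≇z) y≅e)
  go (inj₂ (inj₁ y≅f)) =
    inj₂ (inj₁ (conclude (endpoints (swap₁₂ x∈) (swap₁₂ z∈) y≅f x≇y z≇y x≇z) y≅f))
  go (inj₂ (inj₂ y≅g)) =
    inj₂ (inj₂ (conclude (endpoints (rotate x∈) (rotate z∈) y≅g x≇y z≇y x≇z) y≅g))

module _ {p : ℕ} .{{_ : NonZero p}} (p-prime : Prime p) (2<p : 2 < p) where

  -- The outer terms differ by `2δ`, which is nonzero because `p` is a prime above 2. The conclusion
  -- no longer mentions `a` or `δ`, so only three congruences between `e`, `f` and `g` remain to be
  -- refuted.
  progression-midpoint : ∀ a {δ} → ¬ (δ ≅ + 0 [mod p ]) →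
    OneOf p e f g a → OneOf p e f g (a ℤ.+ δ) → OneOf p e f g (a ℤ.+ + 2 ℤ.* δ) →
    f ℤ.+ g ≅ + 2 ℤ.* e [mod p ] ⊎ e ℤ.+ g ≅ + 2 ℤ.* f [mod p ] ⊎ e ℤ.+ f ≅ + 2 ℤ.* g [mod p ]
  progression-midpoint a {δ} δ≇0 a₀∈ a₁∈ a₂∈ = midpoint a₀∈ a₁∈ a₂∈
    (λ a₀≅a₁ → δ≇0 (linear (- (+ 1)) a₀≅a₁ (solve (a ∷ δ ∷ []))))
    (λ a₂≅a₁ → δ≇0 (linear (+ 1) a₂≅a₁ (solve (a ∷ δ ∷ []))))
    (λ a₀≅a₂ → multiple≇0 p-prime δ≇0 2 2<p (linear (- (+ 1)) a₀≅a₂ (solve (a ∷ δ ∷ []))))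
    (≅-reflexive (solve (a ∷ δ ∷ [])))

-- Arithmetic progressions with integer parameters.

module _ {n : ℕ} .{{_ : NonZero n}} where

  -- Integer parameters make the terms accessible to ring identities. Of the two inclusions, the
  -- first places terms inside `B`, the second keeps classes before the first term out of `A`.
  IsIntegerProgression : Subset n → ℤ → ℤ → Set
  IsIntegerProgression S a δ =
    ¬ (δ ≅ + 0 [mod n ]) ×
    (∀ i → i < ∣ S ∣ → residue (a ℤ.+ + i ℤ.* δ) ∈ S) ×
    (∀ x → residue x ∈ S → ∃[ i ] (i < ∣ S ∣ × x ≅ a ℤ.+ + i ℤ.* δ [mod n ]))

  integerProgression : ∀ {S} → IsArithmeticProgression S → ∃[ a ] ∃[ δ ] IsIntegerProgression S a δ
  integerProgression {S} (a₀ , d , d≢0 , S-terms) =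
    a , δ ,
    (λ δ≅0 → d≢0 (trans (sym (residue-toℕ d)) (residue-cong δ≅0))) ,
    (λ i i<∣S∣ → Equivalence.from (S-terms _) (i , i<∣S∣ , sym (term i))) ,
    λ x x∈S → let i , i<∣S∣ , eq = Equivalence.to (S-terms _) x∈S in
      i , i<∣S∣ , residue-injective (trans eq (term i))
    where
    a = + toℕ a₀
    δ = + toℕ d
    term : ∀ i → a₀ ⊕ residue (+ i) ⊗ d ≡ residue (a ℤ.+ + i ℤ.* δ)
    term i = trans
      (cong₂ (λ u v → u ⊕ residue (+ i) ⊗ v) (sym (residue-toℕ a₀)) (sym (residue-toℕ d)))
      (trans (cong (residue a ⊕_) (residue-⊗ (+ i) δ)) (residue-⊕ a (+ i ℤ.* δ)))

-- If `a - mδ` were the term `a + iδ`, then `(i + m)δ` would vanish, although `0 < i + m < p`.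
before-progression : ∀ {p} .{{_ : NonZero p}} → Prime p → ∀ {S} a {δ} → IsIntegerProgression {p} S a δ →
  ∀ m .{{_ : NonZero m}} → ∣ S ∣ + m ≤ p → residue (a - + m ℤ.* δ) ∉ S
before-progression p-prime a {δ} (δ≇0 , _ , S⊆terms) m ∣S∣+m≤p x∈S
  with i , i<∣S∣ , x≅term ← S⊆terms (a - + m ℤ.* δ) x∈S =
  multiple≇0 p-prime δ≇0 (i + m) {{>-nonZero (ℕ.<-≤-trans (>-nonZero⁻¹ m) (ℕ.m≤n+m m i))}}
    (ℕ.<-≤-trans (ℕ.+-monoˡ-< m i<∣S∣) ∣S∣+m≤p)
    (linear (- (+ 1)) x≅term
      (trans (cong (λ t → t ℤ.* δ - + 0) (ℤ.pos-+ i m)) (identity (+ i) (+ m))))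
  where
  identity : ∀ i m → (i ℤ.+ m) ℤ.* δ - + 0 ≡ - (+ 1) ℤ.* ((a - m ℤ.* δ) - (a ℤ.+ i ℤ.* δ))
  identity i m = solve (i ∷ m ∷ a ∷ δ ∷ [])

-- The sets `A` and `B` and their sizes.

module Construction {p : ℕ} .{{_ : NonZero p}} (p-prime : Prime p) (11≤p : 11 ≤ p)
                    (c : ℤ) (2c≡-1 : (+ 2) ℤ.* c ≡ - (+ 1) [mod p ]) where

  A B complement : Subset p
  B = ⁅ residue (+ 0) ⁆ ∪ ⁅ residue (+ 1) ⁆ ∪ ⁅ residue c ⁆
  complement = ⁅ residue (- (+ 1)) ⁆ ∪ ⁅ residue (- c) ⁆ ∪ ⁅ residue (- (+ 2)) ⁆
  A = ∁ complement

  2c≅-1 : (+ 2) ℤ.* c ≅ - (+ 1) [mod p ]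
  2c≅-1 = congruent (∣ᵤ⇒∣ 2c≡-1)

  -- Every coincidence to be excluded below reduces to `p` dividing one of 1, 2, 3, 4, 5, 7, all
  -- less than 11.
  small : ∀ m .{{_ : NonZero m}} {m<11 : True (m ℕ.<? 11)} → ¬ (+ m ≅ + 0 [mod p ])
  small m {m<11} = small≇0 m (ℕ.<-≤-trans (toWitness m<11) 11≤p)

  ∈B⁻ : ∀ x → residue x ∈ B → OneOf p (+ 0) (+ 1) c x
  ∈B⁻ x = triple⁻ x (+ 0) (+ 1) c

  ∈complement⁻ : ∀ x → residue x ∈ complement → OneOf p (- (+ 1)) (- c) (- (+ 2)) x
  ∈complement⁻ x = triple⁻ x (- (+ 1)) (- c) (- (+ 2))

  ∣B∣≡3 : ∣ B ∣ ≡ 3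
  ∣B∣≡3 = ∣triple∣≡3 (+ 0) (+ 1) c
    (λ 0≅1 → small 1 (linear (- (+ 1)) 0≅1 refl))
    -- `c` is eliminated: `2(0 - c) + (2c + 1) = 1`. Later coefficients are likewise chosen so that
    -- the assumed coincidence and `2c + 1` combine to a constant.
    (λ 0≅c → small 1 (bilinear (+ 2) (+ 1) 0≅c 2c≅-1 (solve (c ∷ []))))
    (λ 1≅c → small 3 (bilinear (+ 2) (+ 1) 1≅c 2c≅-1 (solve (c ∷ []))))

  ∣complement∣≡3 : ∣ complement ∣ ≡ 3
  ∣complement∣≡3 = ∣triple∣≡3 (- (+ 1)) (- c) (- (+ 2))
    (λ -1≅-c → small 3 (bilinear (- (+ 2)) (+ 1) -1≅-c 2c≅-1 (solve (c ∷ []))))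
    (λ -1≅-2 → small 1 (linear (+ 1) -1≅-2 refl))
    (λ -c≅-2 → small 5 (bilinear (+ 2) (+ 1) -c≅-2 2c≅-1 (solve (c ∷ []))))

  ∣A∣≡p∸3 : ∣ A ∣ ≡ p ∸ 3
  ∣A∣≡p∸3 = trans (∣∁p∣≡n∸∣p∣ complement) (cong (p ∸_) ∣complement∣≡3)

  ∣A∣+3≡p : ∣ A ∣ + 3 ≡ p
  ∣A∣+3≡p = trans (cong (_+ 3) ∣A∣≡p∸3)
    (ℕ.m∸n+n≡m (ℕ.≤-trans (toWitness {a? = 3 ℕ.≤? 11} _) 11≤p))

  -- The restricted sumset.

  missing : Subset p
  missing = ⁅ residue (+ 0) ⁆ ∪ ⁅ residue (- (+ 1)) ⁆

  -- For each sum 0 or -1 and each `b`, the forced value of `a` is either one of the three classes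
  -- omitted from `A` or `b` itself. The latter happens for `0 = 0 + 0` and `-1 = c + c`.
  missing-unattained : ∀ a b → ¬ OneOf p (- (+ 1)) (- c) (- (+ 2)) a → OneOf p (+ 0) (+ 1) c b →
    ¬ (a ≅ b [mod p ]) → ¬ (a ℤ.+ b ≅ + 0 [mod p ] ⊎ a ℤ.+ b ≅ - (+ 1) [mod p ])
  missing-unattained a b a∉ (inj₁ b≅0) a≇b (inj₁ s≅0) =
    a≇b (bilinear (+ 1) (- (+ 2)) s≅0 b≅0 (solve (a ∷ b ∷ [])))
  missing-unattained a b a∉ (inj₁ b≅0) a≇b (inj₂ s≅-1) =
    a∉ (inj₁ (bilinear (+ 1) (- (+ 1)) s≅-1 b≅0 (solve (a ∷ b ∷ []))))
  missing-unattained a b a∉ (inj₂ (inj₁ b≅1)) a≇b (inj₁ s≅0) =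
    a∉ (inj₁ (bilinear (+ 1) (- (+ 1)) s≅0 b≅1 (solve (a ∷ b ∷ []))))
  missing-unattained a b a∉ (inj₂ (inj₁ b≅1)) a≇b (inj₂ s≅-1) =
    a∉ (inj₂ (inj₂ (bilinear (+ 1) (- (+ 1)) s≅-1 b≅1 (solve (a ∷ b ∷ [])))))
  missing-unattained a b a∉ (inj₂ (inj₂ b≅c)) a≇b (inj₁ s≅0) =
    a∉ (inj₂ (inj₁ (bilinear (+ 1) (- (+ 1)) s≅0 b≅c (solve (a ∷ b ∷ c ∷ [])))))
  missing-unattained a b a∉ (inj₂ (inj₂ b≅c)) a≇b (inj₂ s≅-1) =
    a≇b (≅-trans
      -- Here `a` is `-1 - c`, which `2c ≡ -1` turns into `c`, hence into `b`.
      (bilinear {x = a} {y = - (+ 1) - c} (+ 1) (- (+ 1)) s≅-1 b≅c (solve (a ∷ b ∷ c ∷ [])))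
      (bilinear {y = b} (- (+ 1)) (- (+ 1)) 2c≅-1 b≅c (solve (b ∷ c ∷ []))))

  restrictedSum : ∀ s a b → s ≅ a ℤ.+ b [mod p ] →
    ¬ OneOf p (- (+ 1)) (- c) (- (+ 2)) a → OneOf p (+ 0) (+ 1) c b →
    ¬ (a ≅ b [mod p ]) → IsRestrictedSum A B (residue s)
  restrictedSum s a b s≅a+b a∉ b∈ a≇b =
    residue a , residue b , x∉p⇒x∈∁p (a∉ ∘ ∈complement⁻ a) , triple⁺ b (+ 0) (+ 1) c b∈ ,
    a≇b ∘ residue-injective {i = a} {b} , trans (residue-cong s≅a+b) (sym (residue-⊕ a b))

  attained : ∀ s → ¬ (s ≅ + 0 [mod p ] ⊎ s ≅ - (+ 1) [mod p ]) → IsRestrictedSum A B (residue s)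
  attained s s∉ =
    [ [ s≅-c-attained , s≅-2-attained ]′ ∘ pair⁻ s (- c) (- (+ 2)) , otherwise ]′
      -- The case split is on membership in a subset, which is decidable.
      (toSum (residue s ∈? (⁅ residue (- c) ⁆ ∪ ⁅ residue (- (+ 2)) ⁆)))
    where
    otherwise : residue s ∉ ⁅ residue (- c) ⁆ ∪ ⁅ residue (- (+ 2)) ⁆ → IsRestrictedSum A B (residue s)
    -- The sum `s + 0`: here `s` avoids all three classes omitted from `A`, and differs from 0.
    otherwise s≇ = restrictedSum s s (+ 0) (≅-reflexive (sym (ℤ.+-identityʳ s)))
      [ s∉ ∘ inj₂ , s≇ ∘ pair⁺ s (- c) (- (+ 2)) ]′ (inj₁ ≅-refl) (s∉ ∘ inj₁)
    s≅-c-attained : s ≅ - c [mod p ] → IsRestrictedSum A B (residue s)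
    -- The sum `c + 1`, since `-c ≡ c + 1` by `2c ≡ -1`.
    s≅-c-attained s≅-c = restrictedSum s c (+ 1)
      (bilinear (+ 1) (- (+ 1)) s≅-c 2c≅-1 (solve (s ∷ c ∷ [])))
      [ (λ c≅-1 → small 1 (bilinear (+ 2) (- (+ 1)) c≅-1 2c≅-1 (solve (c ∷ []))))
      , [ (λ c≅-c → small 1 (bilinear (- (+ 1)) (+ 1) c≅-c 2c≅-1 (solve (c ∷ []))))
        , (λ c≅-2 → small 3 (bilinear (+ 2) (- (+ 1)) c≅-2 2c≅-1 (solve (c ∷ []))))
        ]′ ]′
      (inj₂ (inj₁ ≅-refl))
      (λ c≅1 → small 3 (bilinear (- (+ 2)) (+ 1) c≅1 2c≅-1 (solve (c ∷ []))))
    s≅-2-attained : s ≅ - (+ 2) [mod p ] → IsRestrictedSum A B (residue s)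
    -- The sum `-3 + 1`; that -3 differs from `-c` is where 7 enters.
    s≅-2-attained s≅-2 = restrictedSum s (- (+ 3)) (+ 1) s≅-2
      [ (λ -3≅-1 → small 2 (linear (- (+ 1)) -3≅-1 refl))
      , [ (λ -3≅-c → small 7 (bilinear (- (+ 2)) (+ 1) -3≅-c 2c≅-1 (solve (c ∷ []))))
        , (λ -3≅-2 → small 1 (linear (- (+ 1)) -3≅-2 refl))
        ]′ ]′
      (inj₂ (inj₁ ≅-refl))
      (λ -3≅1 → small 4 (linear (- (+ 1)) -3≅1 refl))

  A+̂B≡∁missing : A +̂ B ≡ ∁ missing
  A+̂B≡∁missing = ⊆-antisym
    (λ {s} s∈ → x∉p⇒x∈∁p (unattained s (∈-tabulate⁻ (isRestrictedSum? A B) s s∈)))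
    (λ {s} s∈ → ∈-tabulate⁺ (isRestrictedSum? A B) s
      (subst (IsRestrictedSum A B) (residue-toℕ s)
        (attained (+ toℕ s) (subst (_∉ missing) (sym (residue-toℕ s)) (x∈∁p⇒x∉p s∈) ∘ pair⁺ _ (+ 0) (- (+ 1))))))
    where
    unattained : ∀ s → IsRestrictedSum A B s → s ∉ missing
    unattained s (a , b , a∈A , b∈B , a≢b , s≡a⊕b) s∈missing = missing-unattained (+ toℕ a) (+ toℕ b)
      (subst (_∉ complement) (sym (residue-toℕ a)) (x∈∁p⇒x∉p a∈A) ∘ triple⁺ _ (- (+ 1)) (- c) (- (+ 2)))
      (∈B⁻ _ (subst (_∈ B) (sym (residue-toℕ b)) b∈B))
      (a≢b ∘ toℕ-injective-mod a b)
      (pair⁻ _ (+ 0) (- (+ 1)) (subst (_∈ missing) s≡a⊕b s∈missing))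

  ∣A+̂B∣≡p∸2 : ∣ A +̂ B ∣ ≡ p ∸ 2
  ∣A+̂B∣≡p∸2 = begin
    ∣ A +̂ B ∣        ≡⟨ cong ∣_∣ A+̂B≡∁missing ⟩
    ∣ ∁ missing ∣     ≡⟨ ∣∁p∣≡n∸∣p∣ missing ⟩
    p ∸ ∣ missing ∣   ≡⟨ cong (p ∸_) (∣pair∣≡2 (+ 0) (- (+ 1)) λ 0≅-1 → small 1 (linear (+ 1) 0≅-1 refl)) ⟩
    p ∸ 2             ∎
    where open ≡-Reasoning

  -- Neither set is an arithmetic progression.

  2<p : 2 < p
  2<p = ℕ.<-≤-trans (toWitness {a? = 2 ℕ.<? 11} _) 11≤p

  B-notIntegerProgression : ∀ a δ → ¬ IsIntegerProgression B a δ
  B-notIntegerProgression a δ (δ≇0 , terms∈B , _) =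
    progression-midpoint p-prime 2<p a δ≇0
      (term 0 z<s (sym (ℤ.+-identityʳ a)))
      (term 1 (s<s z<s) (cong (λ t → a ℤ.+ t) (sym (ℤ.*-identityˡ δ))))
      (term 2 (s<s (s<s z<s)) refl)
    |>′
    -- With midpoint 0, 1 or `c` respectively, `p` would divide 1, 5 or 2.
    [ (λ 1+c≅0 → small 1 (bilinear (+ 2) (- (+ 1)) 1+c≅0 2c≅-1 (solve (c ∷ []))))
    , [ (λ c≅2 → small 5 (bilinear (- (+ 2)) (+ 1) c≅2 2c≅-1 (solve (c ∷ []))))
      , (λ 1≅2c → small 2 (bilinear (+ 1) (+ 1) 1≅2c 2c≅-1 (solve (c ∷ []))))
      ]′ ]′
    where
    term : ∀ i → i < 3 → x ≡ a ℤ.+ + i ℤ.* δ → OneOf p (+ 0) (+ 1) c x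
    term i i<3 refl = ∈B⁻ _ (terms∈B i (subst (i <_) (sym ∣B∣≡3) i<3))

  -- The midpoint argument applies to a - 3δ, a - 2δ, a - δ, which A omits.
  A-notIntegerProgression : ∀ a δ → ¬ IsIntegerProgression A a δ
  A-notIntegerProgression a δ A-terms@(δ≇0 , _) =
    progression-midpoint p-prime 2<p (a - + 3 ℤ.* δ) δ≇0
      (before 3 ℕ.≤-refl refl)
      (before {a - + 3 ℤ.* δ ℤ.+ δ} 2 (ℕ.n≤1+n 2) (solve (a ∷ δ ∷ [])))
      (before {a - + 3 ℤ.* δ ℤ.+ + 2 ℤ.* δ} 1 (ℕ.m≤m+n 1 2) (solve (a ∷ δ ∷ [])))
    |>′
    -- With midpoint -1, `-c` or -2 respectively, `p` would divide 1, 4 or 7.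
    [ (λ -c-2≅-2 → small 1 (bilinear (+ 2) (+ 1) -c-2≅-2 2c≅-1 (solve (c ∷ []))))
    , [ (λ -3≅-2c → small 4 (bilinear (- (+ 1)) (+ 1) -3≅-2c 2c≅-1 (solve (c ∷ []))))
      , (λ -1-c≅-4 → small 7 (bilinear (+ 2) (+ 1) -1-c≅-4 2c≅-1 (solve (c ∷ []))))
      ]′ ]′
    where
    before : ∀ m .{{_ : NonZero m}} → m ≤ 3 → x ≡ a - + m ℤ.* δ →
             OneOf p (- (+ 1)) (- c) (- (+ 2)) x
    -- Since `∣ A ∣ + 3 ≡ p`, exactly three steps back are available before the progression could
    -- wrap around into `A`.
    before m m≤3 refl = ∈complement⁻ _ (x∉∁p⇒x∈p (before-progression p-prime a A-terms m
      (ℕ.≤-trans (ℕ.+-monoʳ-≤ ∣ A ∣ m≤3) (ℕ.≤-reflexive ∣A∣+3≡p))))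

theorem2p3 :
    (p : ℕ) .{{_ : NonZero p}} → Prime p → 11 ≤ p →
    (c : ℤ) → (+ 2) ℤ.* c ≡ - (+ 1) [mod p ] →
    let B : Subset p
        B = ⁅ residue (+ 0) ⁆ ∪ ⁅ residue (+ 1) ⁆ ∪ ⁅ residue c ⁆
        A : Subset p
        A = ∁ (⁅ residue (- (+ 1)) ⁆ ∪ ⁅ residue (- c) ⁆ ∪ ⁅ residue (- (+ 2)) ⁆)
    in (∣ A ∣ ≡ p ∸ 3)
     × (∣ B ∣ ≡ 3)
     × (∣ A ∣ + ∣ B ∣ ≡ p)
     × (∣ A +̂ B ∣ ≡ p ∸ 2)
     × (¬ IsArithmeticProgression A)
     × (¬ IsArithmeticProgression B)
theorem2p3 p p-prime 11≤p c 2c≡-1 =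
  ∣A∣≡p∸3 , ∣B∣≡3 , trans (cong (λ m → ∣ A ∣ + m) ∣B∣≡3) ∣A∣+3≡p , ∣A+̂B∣≡p∸2 ,
  (λ A-AP → let a , δ , A-terms = integerProgression A-AP in A-notIntegerProgression a δ A-terms) ,
  (λ B-AP → let a , δ , B-terms = integerProgression B-AP in B-notIntegerProgression a δ B-terms)
  where open Construction p-prime 11≤p c 2c≡-1
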